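{- Let $\mathcal{F}$ be a Fraïssé class in a countable signature whose Fraïssé limit $U$ is finite. Assume $A$ is a substructure of $U$ such that there exists $h\in\operatorname{Aut}(U)$ with $h\neq\mathrm{id}_U$ and $h\restriction A=\mathrm{id}_A$. Then $\mathcal{F}$ admits no Katětov functor.
   Context: A structure is a model of a first-order language, possibly with algebraic operations. An embedding is a one-to-one mapping that is an isomorphism onto its image. A substructure of $M$ is a subset closed under all operations of $M$ (in particular containing all constants), with induced relations. The age of a structure $M$ is the class of all finitely generated structures embeddable into $M$. A Fraïssé class is a class of finitely generated structures, closed under isomorphism, with countably many isomorphism types, that is hereditary (closed under finitely generated substructures) and has the joint embedding and amalgamation properties (for embeddings); its Fraïssé limit is the unique (up to isomorphism) countable homogeneous structure whose age is the class. A structure is homogeneous if every isomorphism between its finitely generated substructures extends to an automorphism of it. For a Fraïssé class $\mathcal{F}$, let ${}^{\mathrm{emb}}\mathcal{F}$ be the category whose objects are structures from $\mathcal{F}$ and whose arrows are all embeddings between them. Let $\sigma\mathcal{F}$ be the class of all countable (possibly finite) structures whose age is contained in $\mathcal{F}$, and ${}^{\mathrm{emb}}\sigma\mathcal{F}$ the category of all embeddings between structures from $\sigma\mathcal{F}$. A Katětov functor on $\mathcal{F}$ is a functor $K\colon {}^{\mathrm{emb}}\mathcal{F}\to{}^{\mathrm{emb}}\sigma\mathcal{F}$ for which there exists a natural transformation $\eta$ from the identity (the inclusion functor of ${}^{\mathrm{emb}}\mathcal{F}$ into ${}^{\mathrm{emb}}\sigma\mathcal{F}$) to $K$ (so each $\eta_X\colon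 X\to K(X)$ is an embedding) such that for every $X\in\mathcal{F}$ and every one-point extension $e\colon X\to X'$ there exists an embedding $f\colon X'\to K(X)$ satisfying $\eta_X=f\circ e$. Here a one-point extension of $X$ is an embedding $e\colon X\to X'$ with $X'\in\mathcal{F}$ such that $X'$ is generated by $e[X]\cup\{x\}$ for some $x\in X'$. -}

module Defs where

open import Level using (Level; _⊔_; suc)
open import Data.Fin.Base using (Fin)
open import Data.List.Base using (List)
import Data.List.Membership.Setoid as Membership
open import Data.Nat.Base using (ℕ)
open import Data.Product.Base using (∃; Σ-syntax; ∃-syntax; _×_; _,_; proj₁; proj₂)
open import Data.Sum.Base using (_⊎_)
open import Data.Vec.Functional using (Vector; map)
open import Data.Vec.Functional.Relation.Binary.Pointwise using (Pointwise)
open import Function.Base using (id; _∘_)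
open import Function.Bundles using (Injection; Inverse; _↣_; _⇔_; mk⇔; Equivalence)
open import Function.Definitions using (Congruent; Injective; Surjective)
open import Relation.Binary.Bundles using (Setoid)
open import Relation.Binary.Definitions using (_Respects_)
import Relation.Binary.Construct.On as On
import Relation.Binary.PropositionalEquality.Properties as ≡
open import Relation.Unary using (Pred; _∈_; _⊆_; _≐_)

private
  variable
    ℓ f g : Level

------------------------------------------------------------------------
-- Signatures and structures

-- Constants are the operation symbols of arity 0.

record Signature (ℓ : Level) : Set (suc ℓ) where
  field
    Op       : Set ℓ
    opArity  : Op → ℕ
    Rel      : Set ℓ
    relArity : Rel → ℕ

record CountableSignature (L : Signature ℓ) : Set ℓ where
  open Signature L
  field
    op-countable  : Op ↣ ℕ
    rel-countable : Rel ↣ ℕ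

-- Underlying sets are setoids, whose _≈_ is the equality of the structure.
-- The empty structure is allowed when there are no constants.

record Structure (L : Signature ℓ) : Set (suc ℓ) where
  open Signature L
  field
    setoid : Setoid ℓ ℓ
  open Setoid setoid public
  field
    op       : (o : Op) → Vector Carrier (opArity o) → Carrier
    op-cong  : (o : Op) → ∀ {xs ys} → Pointwise _≈_ xs ys → op o xs ≈ op o ys
    rel      : (r : Rel) → Pred (Vector Carrier (relArity r)) ℓ
    rel-resp : (r : Rel) → rel r Respects Pointwise _≈_

∣_∣ : {L : Signature ℓ} → Structure L → Set ℓ
∣ M ∣ = Structure.Carrier M

Countable : {L : Signature ℓ} → Structure L → Set ℓ
Countable M = Injection (Structure.setoid M) (≡.setoid ℕ)

Finite : {L : Signature ℓ} → Structure L → Set ℓ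
Finite M = ∃[ n ] Inverse (≡.setoid (Fin n)) (Structure.setoid M)

------------------------------------------------------------------------
-- Embeddings and isomorphisms

record Embedding {L : Signature ℓ} (M N : Structure L) : Set ℓ where
  open Signature L
  private
    module M = Structure M
    module N = Structure N
  field
    to        : ∣ M ∣ → ∣ N ∣
    cong      : Congruent M._≈_ N._≈_ to
    injective : Injective M._≈_ N._≈_ to
    op-homo   : ∀ o xs → to (M.op o xs) N.≈ N.op o (map to xs)
    rel-iff   : ∀ r xs → M.rel r xs ⇔ N.rel r (map to xs)

infixl 20 _$_

_$_ : {L : Signature ℓ} {M N : Structure L} → Embedding M N → ∣ M ∣ → ∣ N ∣
_$_ = Embedding.to

record Isomorphism {L : Signature ℓ} (M N : Structure L) : Set ℓ where
  field
    embedding  : Embedding M N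
    surjective : Surjective (Structure._≈_ M) (Structure._≈_ N) (embedding $_)

open Isomorphism public using (embedding)

Automorphism : {L : Signature ℓ} → Structure L → Set ℓ
Automorphism M = Isomorphism M M

infix 4 _≗_

_≗_ : {L : Signature ℓ} {M N : Structure L} → Embedding M N → Embedding M N → Set ℓ
_≗_ {N = N} e e′ = ∀ x → e $ x ≈ e′ $ x
  where open Structure N using (_≈_)

idₑ : {L : Signature ℓ} (M : Structure L) → Embedding M M
idₑ M = record
  { to        = id
  ; cong      = id
  ; injective = id
  ; op-homo   = λ _ _ → Structure.refl M
  ; rel-iff   = λ _ _ → mk⇔ id id
  }

infixr 9 _∘ₑ_

_∘ₑ_ : {L : Signature ℓ} {M N P : Structure L} →
       Embedding N P → Embedding M N → Embedding M P
_∘ₑ_ {P = P} e′ e = record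
  { to        = E′.to ∘ E.to
  ; cong      = E′.cong ∘ E.cong
  ; injective = E.injective ∘ E′.injective
  ; op-homo   = λ o xs →
      Structure.trans P (E′.cong (E.op-homo o xs)) (E′.op-homo o (map E.to xs))
  ; rel-iff   = λ r xs → mk⇔
      (Equivalence.to (E′.rel-iff r _) ∘ Equivalence.to (E.rel-iff r xs))
      (Equivalence.from (E.rel-iff r xs) ∘ Equivalence.from (E′.rel-iff r _))
  }
  where
  module E  = Embedding e
  module E′ = Embedding e′

------------------------------------------------------------------------
-- Substructures and generation

record Substructure {L : Signature ℓ} (M : Structure L) : Set (suc ℓ) where
  open Signature L
  open Structure M
  field
    member    : Pred Carrier ℓ
    resp      : member Respects _≈_
    op-closed : ∀ o xs → (∀ i → xs i ∈ member) → op o xs ∈ member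

open Substructure public using (member)

induced : {L : Signature ℓ} {M : Structure L} → Substructure M → Structure L
induced {M = M} P = record
  { setoid   = On.setoid setoid (proj₁ {B = P.member})
  ; op       = λ o xs → op o (map proj₁ xs) , P.op-closed o (map proj₁ xs) (proj₂ ∘ xs)
  ; op-cong  = λ o → op-cong o
  ; rel      = λ r xs → rel r (map proj₁ xs)
  ; rel-resp = λ r → rel-resp r
  }
  where
  open Structure M
  module P = Substructure P

-- The underlying set of the least substructure of M containing S.

data Generated {L : Signature ℓ} (M : Structure L) (S : Pred ∣ M ∣ ℓ) : Pred ∣ M ∣ ℓ where
  base : ∀ {x} → x ∈ S → x ∈ Generated M S
  resp : Generated M S Respects Structure._≈_ M
  op   : ∀ o xs → (∀ i → xs i ∈ Generated M S) → Structure.op M o xs ∈ Generated M S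

_GeneratedBy_ : {L : Signature ℓ} (M : Structure L) → Pred ∣ M ∣ ℓ → Set ℓ
M GeneratedBy S = ∀ x → x ∈ Generated M S

FinitelyGenerated : {L : Signature ℓ} → Structure L → Set ℓ
FinitelyGenerated M = ∃[ xs ] M GeneratedBy (_∈ₗ xs)
  where open Membership (Structure.setoid M) renaming (_∈_ to _∈ₗ_)

Age : {L : Signature ℓ} → Structure L → Pred (Structure L) ℓ
Age M X = FinitelyGenerated X × Embedding X M

Homogeneous : {L : Signature ℓ} → Structure L → Set (suc ℓ)
Homogeneous M =
  (P Q : Substructure M) →
  FinitelyGenerated (induced P) → FinitelyGenerated (induced Q) →
  (φ : Isomorphism (induced P) (induced Q)) →
  Σ[ h ∈ Automorphism M ]
    (∀ p → embedding h $ proj₁ p ≈ proj₁ (embedding φ $ p))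
  where open Structure M using (_≈_)

------------------------------------------------------------------------
-- Fraïssé classes

record IsFraisseClass {L : Signature ℓ} (F : Pred (Structure L) f) : Set (suc ℓ ⊔ f) where
  field
    finitelyGenerated : F ⊆ FinitelyGenerated
    iso-closed        : ∀ {X Y} → Isomorphism X Y → X ∈ F → Y ∈ F
    -- The terms of the sequence need not belong to F.
    countablyMany     : Σ[ E ∈ (ℕ → Structure L) ]
                          (∀ {X} → X ∈ F → ∃[ n ] Isomorphism X (E n))
    hereditary        : ∀ {X} → X ∈ F → (P : Substructure X) →
                        FinitelyGenerated (induced P) → induced P ∈ F
    jointEmbedding    : ∀ {X Y} → X ∈ F → Y ∈ F →
                        Σ[ Z ∈ Structure L ] Z ∈ F × Embedding X Z × Embedding Y Z
    amalgamation      : ∀ {Z X Y} → Z ∈ F → X ∈ F → Y ∈ F →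
                        (i : Embedding Z X) (j : Embedding Z Y) →
                        Σ[ W ∈ Structure L ] W ∈ F ×
                          (Σ[ i′ ∈ Embedding X W ] Σ[ j′ ∈ Embedding Y W ]
                            i′ ∘ₑ i ≗ j′ ∘ₑ j)

record IsFraisseLimit {L : Signature ℓ} (F : Pred (Structure L) f) (U : Structure L)
       : Set (suc ℓ ⊔ f) where
  field
    countable   : Countable U
    homogeneous : Homogeneous U
    age         : Age U ≐ F

-- Countable structures whose age is contained in F.

σ : {L : Signature ℓ} → Pred (Structure L) f → Pred (Structure L) (suc ℓ ⊔ f)
σ F M = Countable M × Age M ⊆ F

------------------------------------------------------------------------
-- Katětov functors

-- Functors between the categories of all embeddings between members of C and
-- of D.  Arrows are compared pointwise, hence the field K₁-cong.

record EmbFunctor {L : Signature ℓ} (C : Pred (Structure L) f) (D : Pred (Structure L) g)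
       : Set (suc ℓ ⊔ f ⊔ g) where
  field
    K₀      : ∃ C → ∃ D
    K₁      : ∀ {X Y : ∃ C} → Embedding (proj₁ X) (proj₁ Y) →
              Embedding (proj₁ (K₀ X)) (proj₁ (K₀ Y))
    K₁-cong : ∀ {X Y : ∃ C} {e e′ : Embedding (proj₁ X) (proj₁ Y)} →
              e ≗ e′ → K₁ {X} {Y} e ≗ K₁ {X} {Y} e′
    K₁-id   : ∀ {X : ∃ C} → K₁ {X} {X} (idₑ (proj₁ X)) ≗ idₑ (proj₁ (K₀ X))
    K₁-∘    : ∀ {X Y Z : ∃ C} (e′ : Embedding (proj₁ Y) (proj₁ Z))
              (e : Embedding (proj₁ X) (proj₁ Y)) →
              K₁ {X} {Z} (e′ ∘ₑ e) ≗ K₁ {Y} {Z} e′ ∘ₑ K₁ {X} {Y} e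

IsOnePointExtension : {L : Signature ℓ} {X X′ : Structure L} → Embedding X X′ → Set ℓ
IsOnePointExtension {X = X} {X′} e =
  ∃[ x ] X′ GeneratedBy (λ y → (∃[ a ] e $ a ≈ y) ⊎ y ≈ x)
  where open Structure X′ using (_≈_)

-- η is a natural transformation from the inclusion of the category on F into
-- that on σ F.  Both are full subcategories of all structures and embeddings, so
-- only the components and their naturality squares matter.

record KatetovFunctor {L : Signature ℓ} (F : Pred (Structure L) f) : Set (suc ℓ ⊔ f) where
  field
    functor : EmbFunctor F (σ F)
  open EmbFunctor functor public
  field
    η       : (X : ∃ F) → Embedding (proj₁ X) (proj₁ (K₀ X))
    natural : ∀ {X Y : ∃ F} (e : Embedding (proj₁ X) (proj₁ Y)) →
              η Y ∘ₑ e ≗ K₁ {X} {Y} e ∘ₑ η X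
    extends : (X X′ : ∃ F) (e : Embedding (proj₁ X) (proj₁ X′)) →
              IsOnePointExtension e →
              Σ[ k ∈ Embedding (proj₁ X′) (proj₁ (K₀ X)) ] η X ≗ k ∘ₑ e

{-# OPTIONS --safe #-}
-- The given A may be enlarged to the proper substructure Fix of fixed points
-- of h, which is decidable.  Finitely generated substructures of K(U) embed into
-- U, so by the pigeonhole principle η_U is onto.  Let i be the inclusion of Fix
-- into U.  Since h ∘ i = i, K(h) fixes the image of K(i) pointwise; it is
-- conjugate to h by η_U, so that image is contained in
-- η_U[Fix] = K(i)[η_Fix[Fix]].  Hence η_Fix is onto as well, and K(Fix) has no
-- room for the one-point extension of Fix by a point moved by h.
module Submission where

open import Defs
open import Level using (Level)
open import Data.Fin.Base using (Fin; zero; suc)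
open import Data.Fin.Properties using (_≟_; any?; injective⇒≤)
open import Data.List.Base as List using (List; []; _∷_; tabulate)
import Data.List.Membership.Setoid as Membership
open import Data.List.Membership.Setoid.Properties using (∈-map⁺; ∈-tabulate⁺)
open import Data.List.Relation.Unary.Any using (here; there)
open import Data.Nat.Base using (zero; suc)
open import Data.Nat.Properties using (1+n≰n)
open import Data.Product.Base using (Σ-syntax; ∃; ∃-syntax; _×_; _,_; proj₁; proj₂)
open import Data.Sum.Base using (_⊎_; inj₁; inj₂)
open import Data.Vec.Functional as Vector using (Vector)
open import Function.Base using (id; _∘_)
open import Function.Bundles using (Injection; Inverse; mk⇔)
open import Function.Construct.Symmetry using (inverse)
open import Function.Definitions using (Injective)
open import Function.Properties.Inverse using (Inverse⇒Injection)
open import Relation.Binary.Definitions using (Decidable)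
open import Relation.Binary.PropositionalEquality as ≡ using (_≡_)
import Relation.Binary.Reasoning.Setoid as ≈-Reasoning
open import Relation.Nullary.Decidable using (yes; no; via-injection; decidable-stable)
open import Relation.Nullary.Negation.Core using (¬_; contradiction)
open import Relation.Unary using (Pred; _∈_; _⊆_)
import Relation.Unary as Unary

private
  variable
    ℓ : Level
    L : Signature ℓ
    M N X X′ : Structure L

-- A value `y` missed by `g` could be prepended to it, giving an injection from `Fin (suc n)` into
-- `Fin n`.
Fin-injective⇒surjective : ∀ {n} {g : Fin n → Fin n} → Injective _≡_ _≡_ g →
                           ∀ y → ∃[ x ] g x ≡ y
Fin-injective⇒surjective {n} {g} g-inj y with any? (λ x → g x ≟ y)
... | yes x,gx≡y = x,gx≡y
... | no  y∉g    = contradiction (injective⇒≤ y∷g-injective) 1+n≰n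
  where
  y∷g-injective : Injective _≡_ _≡_ (y Vector.∷ g)
  y∷g-injective {zero}  {zero}  _  = ≡.refl
  y∷g-injective {zero}  {suc j} eq = contradiction (j , ≡.sym eq) y∉g
  y∷g-injective {suc i} {zero}  eq = contradiction (i , eq) y∉g
  y∷g-injective {suc i} {suc j} eq = ≡.cong suc (g-inj eq)

module FiniteStructure {L : Signature ℓ} (M : Structure L) (fin : Finite M) where
  open Structure M
  open Inverse (proj₂ fin) using (to; from; strictlyInverseˡ)

  private
    module To   = Injection (Inverse⇒Injection (proj₂ fin))
    module From = Injection (Inverse⇒Injection (inverse (proj₂ fin)))

  infix 4 _≈?_

  _≈?_ : Decidable _≈_
  _≈?_ = via-injection (Inverse⇒Injection (inverse (proj₂ fin))) _≟_

  endo-surjective : (e : Embedding M M) → ∀ y → ∃[ x ] e $ x ≈ y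
  endo-surjective e y =
    let i , eq = Fin-injective⇒surjective {g = from ∘ (e $_) ∘ to}
                   (To.injective ∘ Embedding.injective e ∘ From.injective) (from y)
    in to i , From.injective eq

  finitelyGenerated : FinitelyGenerated M
  finitelyGenerated = tabulate to ,
    λ x → resp (strictlyInverseˡ x) (base (∈-tabulate⁺ setoid (from x)))

  module _ (P : Substructure M) (P? : Unary.Decidable (member P)) where
    open Structure (induced P) using () renaming (setoid to P-setoid)
    open Membership P-setoid using () renaming (_∈_ to _∈ₗ_)

    private
      -- Filters the entries of `v` by `P?`. Equality in `induced P` ignores membership proofs, so
      -- the single proof `q` found for an entry serves every `p` lying over it.
      covered : ∀ {n} (v : Vector Carrier n) →
                Σ[ ps ∈ List (∃ (member P)) ] ∀ p i → proj₁ p ≈ v i → p ∈ₗ ps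
      covered {zero}  v = [] , λ _ ()
      covered {suc n} v with P? (v zero) | covered (Vector.tail v)
      ... | yes q | ps , ∈ps = (v zero , q) ∷ ps , λ where
        p zero    eq → here eq
        p (suc i) eq → there (∈ps p i eq)
      ... | no ¬q | ps , ∈ps = ps , λ where
        p zero    eq → contradiction (Substructure.resp P eq (proj₂ p)) ¬q
        p (suc i) eq → ∈ps p i eq

    induced-finitelyGenerated : FinitelyGenerated (induced P)
    induced-finitelyGenerated = proj₁ (covered to) ,
      λ p → base (proj₂ (covered to) p (from (proj₁ p)) (sym (strictlyInverseˡ (proj₁ p))))

generated-⊆ : {S T : Pred ∣ M ∣ _} → S ⊆ Generated M T → Generated M S ⊆ Generated M T
generated-⊆ S⊆ (base s)     = S⊆ s
generated-⊆ S⊆ (resp eq g)  = resp eq (generated-⊆ S⊆ g)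
generated-⊆ S⊆ (op o xs gs) = op o xs (λ i → generated-⊆ S⊆ (gs i))

generated-image : (e : Embedding M N) {S : Pred ∣ M ∣ _} {T : Pred ∣ N ∣ _} →
                  (∀ {x} → x ∈ S → (e $ x) ∈ T) →
                  ∀ {x} → x ∈ Generated M S → (e $ x) ∈ Generated N T
generated-image e S⊆ (base s)     = base (S⊆ s)
generated-image e S⊆ (resp eq g)  = resp (Embedding.cong e eq) (generated-image e S⊆ g)
generated-image {N = N} e S⊆ (op o xs gs) =
  resp (Structure.sym N (Embedding.op-homo e o xs))
       (op o _ (λ i → generated-image e S⊆ (gs i)))

-- The images of the generators of `X` generate the image of `X`, so only `x` has to be added to
-- them.
onePointExtension-finitelyGenerated :
  (e : Embedding X X′) → FinitelyGenerated X → IsOnePointExtension e → FinitelyGenerated X′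
onePointExtension-finitelyGenerated {X = X} {X′ = X′} e (xs , X-gen) (x , X′-gen) =
  x ∷ List.map (e $_) xs , λ y → generated-⊆ (λ where
    (inj₁ (a , ea≈y)) → resp ea≈y (generated-image e
      (there ∘ ∈-map⁺ (Structure.setoid X) (Structure.setoid X′) (Embedding.cong e))
      (X-gen a))
    (inj₂ y≈x) → base (here y≈x)) (X′-gen y)

inclusion : (P : Substructure M) → Embedding (induced P) M
inclusion {M = M} P = record
  { to        = proj₁
  ; cong      = id
  ; injective = id
  ; op-homo   = λ _ _ → Structure.refl M
  ; rel-iff   = λ _ _ → mk⇔ id id
  }

-- The substructure of `M` generated by the image of `e` and `x`, presented as a one-point extension
-- of `X`; `x` may already lie in the image. It is used inside `KU`, over `U`, and inside `U`, over
-- `Fix`.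
module Adjoin {L : Signature ℓ} {X M : Structure L} (e : Embedding X M) (x : ∣ M ∣) where
  open Structure M using (_≈_; refl; sym)

  Generator : Pred ∣ M ∣ _
  Generator y = (∃[ a ] e $ a ≈ y) ⊎ y ≈ x

  substructure : Substructure M
  substructure = record
    { member    = Generated M Generator
    ; resp      = resp
    ; op-closed = op
    }

  structure : Structure L
  structure = induced substructure

  point : ∣ structure ∣
  point = x , base (inj₂ refl)

  extension : Embedding X structure
  extension = record
    { to        = λ a → e $ a , base (inj₁ (a , refl))
    ; cong      = e.cong
    ; injective = e.injective
    ; op-homo   = e.op-homo
    ; rel-iff   = e.rel-iff
    }
    where module e = Embedding e

  isOnePointExtension : IsOnePointExtension extension
  isOnePointExtension = point , λ (y , g) → generated g
    where
    -- The membership proof of a point is itself a derivation from the generators, and induction on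
    -- it replays that derivation inside `structure`.
    generated : ∀ {y} (g : y ∈ Generated M Generator) →
                (y , g) ∈ Generated structure (Generator ∘ proj₁)
    generated (base s)     = base s
    generated (resp eq g)  = resp eq (generated g)
    generated (op o xs gs) = op o (λ i → xs i , gs i) (λ i → generated (gs i))

  structure∈Age : FinitelyGenerated X → structure ∈ Age M
  structure∈Age X-fg =
    onePointExtension-finitelyGenerated extension X-fg isOnePointExtension ,
    inclusion substructure

fixedPoints : Embedding M M → Substructure M
fixedPoints {M = M} h = record
  { member    = λ x → h $ x ≈ x
  ; resp      = λ x≈y hx≈x → trans (h.cong (sym x≈y)) (trans hx≈x x≈y)
  ; op-closed = λ o xs fixed → trans (h.op-homo o xs) (op-cong o fixed)
  }
  where
  open Structure M
  module h = Embedding h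

proposition1p2 : {ℓ f : Level} (L : Signature ℓ) → CountableSignature L →
    (F : Pred (Structure L) f) → IsFraisseClass F →
    (U : Structure L) → IsFraisseLimit F U → Finite U →
    (A : Substructure U) →
    (Σ[ h ∈ Automorphism U ]
    (¬ (embedding h ≗ idₑ U) ×
    (∀ x → x ∈ member A → Structure._≈_ U (embedding h $ x) x))) →
    ¬ KatetovFunctor F
proposition1p2 L _ F _ U U-limit U-finite _ (h-auto , h≢id , _) K =
  h≢id (λ x → decidable-stable (h $ x ≈? x) (λ x-moved → x-moved (fixed x)))
  where
  open Structure U using (_≈_)
  open FiniteStructure U U-finite using (_≈?_; endo-surjective; finitelyGenerated;
                                         induced-finitelyGenerated)
  open KatetovFunctor K

  h : Embedding U U
  h = embedding h-auto

  age⊆F : Age U ⊆ F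
  age⊆F = proj₁ (IsFraisseLimit.age U-limit)

  F⊆age : F ⊆ Age U
  F⊆age = proj₂ (IsFraisseLimit.age U-limit)

  Fix : Substructure U
  Fix = fixedPoints h

  Fix-fg : FinitelyGenerated (induced Fix)
  Fix-fg = induced-finitelyGenerated Fix (λ x → h $ x ≈? x)

  i : Embedding (induced Fix) U
  i = inclusion Fix

  Uᶠ Fixᶠ : ∃ F
  Uᶠ   = U , age⊆F (finitelyGenerated , idₑ U)
  Fixᶠ = induced Fix , age⊆F (Fix-fg , i)

  KU = proj₁ (K₀ Uᶠ)
  open Structure KU using () renaming (_≈_ to _≈ᴷ_; sym to symᴷ; trans to transᴷ)

  Ki : Embedding (proj₁ (K₀ Fixᶠ)) KU
  Ki = K₁ {Fixᶠ} {Uᶠ} i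

  Kh : Embedding KU KU
  Kh = K₁ {Uᶠ} {Uᶠ} h

  η-surjective : ∀ y → ∃[ u ] η Uᶠ $ u ≈ᴷ y
  η-surjective y =
    -- As `KU` has its age in `F`, the structure generated by the image of `η Uᶠ` and `y` embeds
    -- into `U` by `g`. Then `g ∘ₑ extension` maps the finite `U` into itself, hence onto, and
    -- already attains the value of `g` at `y`.
    let u , gηu≈gy = endo-surjective (g ∘ₑ extension) (g $ point)
    in u , Embedding.injective g gηu≈gy
    where
    open Adjoin (η Uᶠ) y
    g : Embedding structure U
    g = proj₂ (F⊆age (proj₂ (proj₂ (K₀ Uᶠ)) (structure∈Age finitelyGenerated)))

  Kh-fixes-Ki : ∀ c → Kh $ (Ki $ c) ≈ᴷ Ki $ c
  Kh-fixes-Ki c = transᴷ (symᴷ (K₁-∘ {Fixᶠ} {Uᶠ} {Uᶠ} h i c))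
                         -- `proj₂` proves `h ∘ₑ i ≗ i`: a point of `Fix` carries the proof that `h`
                         -- fixes it.
                         (K₁-cong {Fixᶠ} {Uᶠ} {h ∘ₑ i} {i} proj₂ c)

  ηFix-surjective : ∀ c → ∃[ a ] Structure._≈_ (proj₁ (K₀ Fixᶠ)) (η Fixᶠ $ a) c
  ηFix-surjective c =
    let u , ηu≈Kic = η-surjective (Ki $ c)
        -- Naturality at `h` carries the fixedness of `Ki $ c` under `Kh` back to `u`, which thereby
        -- becomes a point of `Fix`.
        hu≈u = Embedding.injective (η Uᶠ) (begin
          η Uᶠ $ (h $ u)  ≈⟨ natural {Uᶠ} {Uᶠ} h u ⟩
          Kh $ (η Uᶠ $ u) ≈⟨ Embedding.cong Kh ηu≈Kic ⟩
          Kh $ (Ki $ c)   ≈⟨ Kh-fixes-Ki c ⟩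
          Ki $ c          ≈⟨ ηu≈Kic ⟨
          η Uᶠ $ u        ∎)
        a = u , hu≈u
    -- Naturality at `i` rewrites `η Uᶠ $ u` as `Ki $ (η Fixᶠ $ a)`, and `Ki` cancels.
    in a , Embedding.injective Ki (transᴷ (symᴷ (natural {Fixᶠ} {Uᶠ} i a)) ηu≈Kic)
    where open ≈-Reasoning (Structure.setoid KU)

  fixed : ∀ x → h $ x ≈ x
  fixed x = Substructure.resp Fix a≈x (proj₂ a)
    where
    open Adjoin i x

    ⟨Fix,x⟩ : ∃ F
    ⟨Fix,x⟩ = structure , age⊆F (structure∈Age Fix-fg)

    extended = extends Fixᶠ ⟨Fix,x⟩ extension isOnePointExtension

    k : Embedding structure (proj₁ (K₀ Fixᶠ))
    k = proj₁ extended

    preimage = ηFix-surjective (k $ point)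

    a : ∣ induced Fix ∣
    a = proj₁ preimage

    open Structure (proj₁ (K₀ Fixᶠ)) using (sym; trans)

    a≈x : i $ a ≈ x
    -- On `Fix`, `k` agrees with `η Fixᶠ`, so it takes the same value at `a` as at the adjoined
    -- point. Equality in `structure` is that of `U`, so cancelling `k` identifies `x` with a fixed
    -- point of `h`.
    a≈x = Embedding.injective k (trans (sym (proj₂ extended a)) (proj₂ preimage))
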